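{- $\mathcal{D}(L_4,1)\le 2/9$.
   Context: $L_n$ denotes the $n$-dimensional lattice graph (here $n=4$): its vertex set is $\mathbb{Z}^n$, and $\{(x_1,\ldots,x_n),(y_1,\ldots,y_n)\}$ is an edge if and only if $\sum_{i=1}^n |x_i-y_i|=1$. For a connected undirected graph $G$ with graph distance $d$, put $B_r(v)=\{u\in V(G): d(u,v)\le r\}$. A code is a nonempty subset $C\subseteq V(G)$. A code $C$ is $r$-identifying if (1) $B_r(v)\cap C\neq\emptyset$ for all $v\in V(G)$, and (2) $B_r(u)\cap C\ne B_r(v)\cap C$ for all $u\neq v$ in $V(G)$. The density of a code $C$ in $L_n$ is $\limsup_{m\to\infty} |C\cap Q_m|/|Q_m|$, where $Q_m$ is the set of $(x_1,\ldots,x_n)\in\mathbb{Z}^n$ with $|x_i|\le m$ for all $i$. $\mathcal{D}(L_n,r)$ denotes the minimum possible density (the infimum over all $r$-identifying codes) of an $r$-identifying code for $L_n$; here $r=1$. -}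

module Defs where

open import Data.Integer.Base as ℤ using (ℤ; +_; -[1+_]; ∣_∣)
import Data.Integer.Properties as ℤ
open import Algebra.Properties.AbelianGroup ℤ.+-0-abelianGroup using (xyx⁻¹≈y; ∙-cancelʳ)
open import Data.List.Base as List using (List; length; filter; upTo; cartesianProductWith)
import Data.List.Membership.Propositional as List
import Data.List.Membership.Propositional.Properties as List
open import Data.List.Relation.Unary.Any using (here)
open import Data.List.Relation.Unary.AllPairs as AllPairs using ()
import Data.List.Relation.Unary.All as ListAll
open import Data.List.Relation.Unary.Unique.Propositional using (Unique)
import Data.List.Relation.Unary.Unique.Propositional.Properties as Unique
open import Data.Nat.Base using (ℕ; zero; suc; NonZero; z≤n; s≤s; _≤_; _+_)
import Data.Nat.Properties as ℕ
open import Data.Product.Base using (∃; ∃-syntax; _×_; _,_; proj₂)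
open import Data.Rational.Base as ℚ using (ℚ; _/_)
import Data.Rational.Properties as ℚ
open import Data.Sum.Base using (inj₁; inj₂)
open import Data.Vec.Base using (Vec; []; _∷_; replicate; sum; zipWith)
open import Data.Vec.Properties using (∷-injective)
open import Data.Vec.Relation.Unary.All using (All; []; _∷_)
open import Function.Bundles using (_⇔_; mk⇔; Equivalence)
open import Level using (Level; 0ℓ; _⊔_) renaming (suc to lsuc)
open import Relation.Binary.Core using (Rel)
open import Relation.Binary.Definitions using (Symmetric; Irreflexive)
open import Relation.Binary.PropositionalEquality
  using (_≡_; _≢_; refl; sym; trans; cong; cong₂; subst)
open import Relation.Nullary using (¬_)
open import Relation.Unary using (Pred; Decidable; Satisfiable; _∈_; _⊆_; _∩_; _≐_)

private variable
  a ℓ ℓ′ : Level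

------------------------------------------------------------------------
-- Upper real numbers

-- An extended real number x is represented by its upper Dedekind cut, the
-- set of all rationals q with x < q.

record UpperReal (ℓ : Level) : Set (lsuc ℓ) where
  field
    cut     : Pred ℚ ℓ
    rounded : ∀ {q} → q ∈ cut ⇔ (∃[ p ] p ∈ cut × p ℚ.< q)

open UpperReal public using (cut)

fromℚ : ℚ → UpperReal 0ℓ
fromℚ r = record
  { cut     = r ℚ.<_
  ; rounded = mk⇔ ℚ.<-dense (λ (_ , r<p , p<q) → ℚ.<-trans r<p p<q)
  }

infix 4 _≤ᵘ_

_≤ᵘ_ : UpperReal ℓ → UpperReal ℓ′ → Set _
x ≤ᵘ y = cut y ⊆ cut x

-- inf x < q iff x i < q for some i.

inf : {I : Set a} → (I → UpperReal ℓ) → UpperReal (a ⊔ ℓ)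
inf x = record
  { cut     = λ q → ∃[ i ] q ∈ cut (x i)
  ; rounded = mk⇔
      (λ (i , q∈) → let p , p∈ , p<q = Equivalence.to (rounded (x i)) q∈
                    in p , (i , p∈) , p<q)
      (λ (p , (i , p∈) , p<q) → i , Equivalence.from (rounded (x i)) (p , p∈ , p<q))
  }
  where open UpperReal using (rounded)

-- sup s < q iff s i ≤ p for all i, for some rational p < q.

sup : {I : Set a} → (I → ℚ) → UpperReal a
sup s = record
  { cut     = λ q → ∃[ p ] p ℚ.< q × (∀ i → s i ℚ.≤ p)
  ; rounded = mk⇔
      (λ (p , p<q , s≤p) → let r , p<r , r<q = ℚ.<-dense p<q
                           in r , (p , p<r , s≤p) , r<q)
      (λ (r , (p , p<r , s≤p) , r<q) → p , ℚ.<-trans p<r r<q , s≤p)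
  }

limsup : (ℕ → ℚ) → UpperReal 0ℓ
limsup s = inf λ N → sup λ k → s (N + k)

------------------------------------------------------------------------
-- Connected graphs and their distance

data Walk {V : Set a} (E : Rel V ℓ) : V → V → ℕ → Set (a ⊔ ℓ) where
  []  : ∀ {v} → Walk E v v 0
  _∷_ : ∀ {u v w k} → E u v → Walk E v w k → Walk E u w (suc k)

record ConnectedGraph : Set₁ where
  field
    Vertex    : Set
    Edge      : Rel Vertex 0ℓ
    symmetric : Symmetric Edge
    loopless  : Irreflexive _≡_ Edge
    connected : ∀ u v → ∃[ k ] Walk Edge u v k

module _ (G : ConnectedGraph) where
  open ConnectedGraph G

  -- HasDistance u v k says that d(u,v) = k: the shortest walks from u to v
  -- have length k.

  HasDistance : Vertex → Vertex → ℕ → Set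
  HasDistance u v k = Walk Edge u v k × (∀ {l} → Walk Edge u v l → k ≤ l)

  Ball : ℕ → Vertex → Pred Vertex 0ℓ
  Ball r v u = ∃[ k ] HasDistance u v k × k ≤ r

  -- Membership is decidable so that the elements of a code in a finite set can
  -- be counted; classically this is no restriction.

  record Code : Set₁ where
    field
      members  : Pred Vertex 0ℓ
      member?  : Decidable members
      nonempty : Satisfiable members

  record IsIdentifying (r : ℕ) (C : Code) : Set where
    open Code C
    field
      covering   : ∀ v → Satisfiable (Ball r v ∩ members)
      separating : ∀ {u v} → u ≢ v → ¬ (Ball r u ∩ members ≐ Ball r v ∩ members)

------------------------------------------------------------------------
-- The lattice graph

module Lattice where

  Point : ℕ → Set
  Point n = Vec ℤ n

  ℓ¹ : ∀ {n} → Point n → Point n → ℕ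
  ℓ¹ x y = sum (zipWith (λ i j → ∣ i ℤ.- j ∣) x y)

  Adjacent : ∀ {n} → Rel (Point n) 0ℓ
  Adjacent x y = ℓ¹ x y ≡ 1

  ∣i-i∣≡0 : ∀ i → ∣ i ℤ.- i ∣ ≡ 0
  ∣i-i∣≡0 i = cong ∣_∣ (ℤ.+-inverseʳ i)

  ℓ¹-refl : ∀ {n} (x : Point n) → ℓ¹ x x ≡ 0
  ℓ¹-refl []      = refl
  ℓ¹-refl (i ∷ x) = cong₂ _+_ (∣i-i∣≡0 i) (ℓ¹-refl x)

  ℓ¹-sym : ∀ {n} (x y : Point n) → ℓ¹ x y ≡ ℓ¹ y x
  ℓ¹-sym []      []      = refl
  ℓ¹-sym (i ∷ x) (j ∷ y) = cong₂ _+_ (ℤ.∣i-j∣≡∣j-i∣ i j) (ℓ¹-sym x y)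

  adjacent-sym : ∀ {n} → Symmetric (Adjacent {n})
  adjacent-sym {x = x} {y} x~y = trans (ℓ¹-sym y x) x~y

  adjacent-irrefl : ∀ {n} → Irreflexive _≡_ (Adjacent {n})
  adjacent-irrefl {x = x} refl x~x with () ← trans (sym (ℓ¹-refl x)) x~x

  _++_ : ∀ {n k l} {x y z : Point n} →
         Walk Adjacent x y k → Walk Adjacent y z l → Walk Adjacent x z (k + l)
  []      ++ q = q
  (e ∷ p) ++ q = e ∷ (p ++ q)

  reverse : ∀ {n k} {x y : Point n} →
            Walk Adjacent x y k → ∃[ l ] Walk Adjacent y x l
  reverse []      = 0 , []
  reverse {x = x} (_∷_ {v = v} e p) =
    _ , proj₂ (reverse p) ++ (adjacent-sym {x = x} {v} e ∷ [])

  forward : ∀ {n} (x : Point n) i d → Walk Adjacent (i ∷ x) ((i ℤ.+ + d) ∷ x) d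
  forward x i zero    = subst (λ j → Walk Adjacent (i ∷ x) (j ∷ x) 0)
                              (sym (ℤ.+-identityʳ i)) []
  forward x i (suc d) = step ∷ subst (λ j → Walk Adjacent _ (j ∷ x) d)
                                     (ℤ.+-assoc i (+ 1) (+ d))
                                     (forward x (i ℤ.+ + 1) d)
    where
    step : Adjacent (i ∷ x) ((i ℤ.+ + 1) ∷ x)
    step = cong₂ _+_
      (trans (ℤ.∣i-j∣≡∣j-i∣ i (i ℤ.+ + 1)) (cong ∣_∣ (xyx⁻¹≈y i (+ 1))))
      (ℓ¹-refl x)

  upwards : ∀ {n} (x : Point n) {i j} → i ℤ.≤ j →
            Walk Adjacent (i ∷ x) (j ∷ x) ∣ j ℤ.- i ∣
  upwards x {i} {j} i≤j =
    subst (λ h → Walk Adjacent (i ∷ x) (h ∷ x) ∣ j ℤ.- i ∣) eq (forward x i ∣ j ℤ.- i ∣)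
    where
    eq : i ℤ.+ + ∣ j ℤ.- i ∣ ≡ j
    eq = trans (cong (λ h → i ℤ.+ h) (ℤ.0≤i⇒+∣i∣≡i (ℤ.i≤j⇒0≤j-i i≤j)))
        (trans (sym (ℤ.+-assoc i j (ℤ.- i))) (xyx⁻¹≈y i j))

  alongFirst : ∀ {n} (x : Point n) i j → ∃[ k ] Walk Adjacent (i ∷ x) (j ∷ x) k
  alongFirst x i j with ℤ.≤-total i j
  ... | inj₁ i≤j = _ , upwards x i≤j
  ... | inj₂ j≤i = reverse (upwards x j≤i)

  lift : ∀ {n k} {x y : Point n} i →
         Walk Adjacent x y k → Walk Adjacent (i ∷ x) (i ∷ y) k
  lift i []      = []
  lift i (e ∷ p) = cong₂ _+_ (∣i-i∣≡0 i) e ∷ lift i p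

  adjacent-connected : ∀ {n} (x y : Point n) → ∃[ k ] Walk Adjacent x y k
  adjacent-connected []      []      = 0 , []
  adjacent-connected (i ∷ x) (j ∷ y) =
    _ , proj₂ (alongFirst x i j) ++ lift j (proj₂ (adjacent-connected x y))

L : ℕ → ConnectedGraph
L n = record
  { Vertex    = Lattice.Point n
  ; Edge      = Lattice.Adjacent
  ; symmetric = λ {x} {y} → Lattice.adjacent-sym {x = x} {y}
  ; loopless  = Lattice.adjacent-irrefl
  ; connected = Lattice.adjacent-connected
  }

------------------------------------------------------------------------
-- Density

-- interval m and Q n m enumerate, without repetition, the integers i with
-- ∣i∣ ≤ m and the points of ℤⁿ all of whose coordinates are such integers.

interval : ℕ → List ℤ
interval m = List.map (λ k → + k ℤ.- + m) (upTo (suc (m + m)))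

Q : (n m : ℕ) → List (Vec ℤ n)
Q zero    m = [] List.∷ List.[]
Q (suc n) m = cartesianProductWith _∷_ (interval m) (Q n m)

∈-interval⁺ : ∀ {m i} → ∣ i ∣ ≤ m → i List.∈ interval m
∈-interval⁺ {m} {i} ∣i∣≤m = subst (List._∈ interval m) eq
    (List.∈-map⁺ (λ k → + k ℤ.- + m) (List.∈-upTo⁺ (s≤s bound)))
  where
  k = ∣ i ℤ.+ + m ∣
  0≤i+m : ∀ i → ∣ i ∣ ≤ m → + 0 ℤ.≤ i ℤ.+ + m
  0≤i+m (+ _)      _   = ℤ.+≤+ z≤n
  0≤i+m (-[1+ j ]) j<m = subst (+ 0 ℤ.≤_) (sym (ℤ.⊖-≥ j<m)) (ℤ.+≤+ z≤n)
  bound : k ≤ m + m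
  bound = ℕ.≤-trans (ℤ.∣i+j∣≤∣i∣+∣j∣ i (+ m)) (ℕ.+-monoˡ-≤ m ∣i∣≤m)
  eq : + k ℤ.- + m ≡ i
  eq = trans (cong (λ h → h ℤ.- + m) (ℤ.0≤i⇒+∣i∣≡i (0≤i+m i ∣i∣≤m)))
      (trans (ℤ.+-assoc i (+ m) (ℤ.- + m))
      (trans (cong (λ h → i ℤ.+ h) (ℤ.+-inverseʳ (+ m))) (ℤ.+-identityʳ i)))

∈-interval⁻ : ∀ {m i} → i List.∈ interval m → ∣ i ∣ ≤ m
∈-interval⁻ {m} i∈ with List.∈-map⁻ (λ k → + k ℤ.- + m) i∈
... | k , k∈ , refl with List.∈-upTo⁻ k∈ | ℕ.≤-total m k
... | s≤s k≤2m | inj₁ m≤k = subst (_≤ m)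
      (sym (trans (cong ∣_∣ (ℤ.m-n≡m⊖n k m)) (cong ∣_∣ (ℤ.⊖-≥ m≤k))))
      (ℕ.≤-trans (ℕ.∸-monoˡ-≤ m k≤2m) (ℕ.≤-reflexive (ℕ.m+n∸n≡m m m)))
... | _        | inj₂ k≤m = subst (_≤ m)
      (sym (trans (ℤ.∣i-j∣≡∣j-i∣ (+ k) (+ m))
           (trans (cong ∣_∣ (ℤ.m-n≡m⊖n m k)) (cong ∣_∣ (ℤ.⊖-≥ k≤m)))))
      (ℕ.m∸n≤m m k)

interval-unique : ∀ m → Unique (interval m)
interval-unique m = Unique.map⁺
  (λ {k} {l} eq → ℤ.+-injective (∙-cancelʳ (ℤ.- + m) (+ k) (+ l) eq))
  (Unique.upTo⁺ _)

∈-Q : ∀ {n m} {x : Vec ℤ n} → x List.∈ Q n m ⇔ All (λ i → ∣ i ∣ ≤ m) x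
∈-Q = mk⇔ to from
  where
  to : ∀ {n m} {x : Vec ℤ n} → x List.∈ Q n m → All (λ i → ∣ i ∣ ≤ m) x
  to {zero}  {x = []} _ = []
  to {suc n} {m} x∈ with List.∈-cartesianProductWith⁻ _∷_ (interval m) (Q n m) x∈
  ... | _ , _ , i∈ , y∈ , refl = ∈-interval⁻ i∈ ∷ to y∈
  from : ∀ {n m} {x : Vec ℤ n} → All (λ i → ∣ i ∣ ≤ m) x → x List.∈ Q n m
  from []       = here refl
  from (p ∷ ps) = List.∈-cartesianProductWith⁺ _∷_ (∈-interval⁺ p) (from ps)

Q-unique : ∀ n m → Unique (Q n m)
Q-unique zero    m = ListAll.[] AllPairs.∷ AllPairs.[]
Q-unique (suc n) m =
  Unique.cartesianProductWith⁺ _∷_ ∷-injective (interval-unique m) (Q-unique n m)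

Q-nonZero : ∀ n m → NonZero (length (Q n m))
Q-nonZero n m = nonZero (Equivalence.from ∈-Q (origin n))
  where
  origin : ∀ n → All (λ i → ∣ i ∣ ≤ m) (replicate n (+ 0))
  origin zero    = []
  origin (suc n) = z≤n ∷ origin n
  nonZero : ∀ {x : Vec ℤ n} {xs} → x List.∈ xs → NonZero (length xs)
  nonZero {xs = _ List.∷ _} _ = _

module _ {n : ℕ} (C : Code (L n)) where
  open Code C

  proportion : ℕ → ℚ
  proportion m =
    _/_ (+ length (filter member? (Q n m))) (length (Q n m)) ⦃ Q-nonZero n m ⦄

  density : UpperReal 0ℓ
  density = limsup proportion

𝒟 : (n r : ℕ) → UpperReal (lsuc 0ℓ)
𝒟 n r = inf {I = ∃ (IsIdentifying (L n) r)} λ (C , _) → density C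

{-# OPTIONS --safe #-}

-- The code consists of the points x ∈ ℤ⁴ for which 3x₁ + 4x₂ + 8x₃ + x₄ is
-- congruent to 0, 1, 3 or 9 modulo 18 (found by computer search).  If two
-- points have the same codewords in their unit balls, then by covering they
-- have one, c, in common, so they are c + x and c + y with x and y of norm at
-- most 1.  Hence both properties of an identifying code are finite checks over
-- the residues modulo 18.  Since x₄ has coefficient 1, a line in the last
-- direction meets the code in exactly 4 of any 18 consecutive points, which
-- gives the density 4/18.
module Submission where

open import Defs
open import Data.Integer.Base as ℤ using (ℤ; +_; -[1+_]; ∣_∣)
open import Data.Integer.DivMod using (_%ℕ_; _/ℕ_; n%ℕd<d; a≡a%ℕn+[a/ℕn]*n)
open import Data.Integer.Divisibility.Signed using (_∣_; divides; _∣?_; ∣m∣n⇒∣m+n)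
import Data.Integer.Properties as ℤ
open import Data.Integer.Tactic.RingSolver using (solve-∀)
open import Data.List.Base as List
  using (List; length; filter; map; upTo; applyUpTo; cartesianProductWith)
import Data.List.Membership.Propositional as List
open import Data.List.Membership.Propositional.Properties using (∈-filter⁺; ∈-upTo⁺)
open import Data.List.Properties
  using (filter-++; filter-≐; length-filter; length-++; length-map; length-applyUpTo
        ; map-∘; map-upTo; length-upTo)
import Data.List.Relation.Unary.All as ListAll
open import Data.List.Relation.Unary.Any as ListAny using (Any; any?; satisfied)
open import Data.Nat.Base as ℕ using (ℕ; zero; suc; NonZero; _≤_; z≤n; s≤s)
open import Data.Nat.DivMod using (m≡m%n+[m/n]*n; m%n<n)
import Data.Nat.Properties as ℕ
import Data.Nat.Tactic.RingSolver as ℕ-Solver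
open import Data.Product.Base using (∃-syntax; _×_; _,_; proj₁; proj₂)
open import Data.Rational.Base as ℚ using (mkℚ; _/_)
import Data.Rational.Properties as ℚ
import Data.Rational.Unnormalised.Base as ℚᵘ
import Data.Rational.Unnormalised.Properties as ℚᵘ
open import Data.Sum.Base using (_⊎_; inj₁; inj₂)
open import Data.Vec.Base using ([]; _∷_; replicate; zipWith; _∷ʳ_)
open import Data.Vec.Properties using (≡-dec)
import Data.Vec.Relation.Unary.All as VecAll
open import Function.Base using (_∘_)
open import Function.Bundles using (Equivalence)
open import Level using (0ℓ)
open import Relation.Binary.Core using (Rel)
open import Relation.Binary.PropositionalEquality
  using (_≡_; _≢_; refl; sym; trans; cong; cong₂; subst; subst₂; module ≡-Reasoning)
open import Relation.Nullary using (¬_; Dec; yes; no; contradiction)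
open import Relation.Nullary.Decidable using (from-yes; _×-dec_; _⊎-dec_; ¬?)
open import Relation.Unary using (Pred; Decidable; Satisfiable; _∈_; _⊆_; _∩_; _≐_)

open Lattice using (Point; ℓ¹; Adjacent; ℓ¹-refl; ℓ¹-sym)

-- Translations and the ℓ¹ distance.

module _ {n : ℕ} where

  𝟎 : Point n
  𝟎 = replicate n (+ 0)

  infixl 6 _⊕_ _⊖_

  _⊕_ _⊖_ : Point n → Point n → Point n
  _⊕_ = zipWith ℤ._+_
  _⊖_ = zipWith ℤ._-_

⊕-⊖ : ∀ {n} (x y : Point n) → x ⊕ (y ⊖ x) ≡ y
⊕-⊖ []      []      = refl
⊕-⊖ (i ∷ x) (j ∷ y) = cong₂ _∷_ (eq i j) (⊕-⊖ x y)
  where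
  eq : ∀ i j → i ℤ.+ (j ℤ.- i) ≡ j
  eq = solve-∀

ℓ¹-translate : ∀ {n} (c x y : Point n) → ℓ¹ (c ⊕ x) (c ⊕ y) ≡ ℓ¹ x y
ℓ¹-translate []      []      []      = refl
ℓ¹-translate (h ∷ c) (i ∷ x) (j ∷ y) =
  cong₂ ℕ._+_ (cong ∣_∣ (eq h i j)) (ℓ¹-translate c x y)
  where
  eq : ∀ h i j → (h ℤ.+ i) ℤ.- (h ℤ.+ j) ≡ i ℤ.- j
  eq = solve-∀

ℓ¹-⊖ : ∀ {n} (x y : Point n) → ℓ¹ (x ⊖ y) 𝟎 ≡ ℓ¹ x y
ℓ¹-⊖ []      []      = refl
ℓ¹-⊖ (i ∷ x) (j ∷ y) = cong₂ ℕ._+_ (cong ∣_∣ (ℤ.+-identityʳ (i ℤ.- j))) (ℓ¹-⊖ x y)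

ℓ¹-⊕ : ∀ {n} (x y : Point n) → ℓ¹ (x ⊕ y) x ≡ ℓ¹ y 𝟎
ℓ¹-⊕ []      []      = refl
ℓ¹-⊕ (i ∷ x) (j ∷ y) = cong₂ ℕ._+_ (cong ∣_∣ (eq i j)) (ℓ¹-⊕ x y)
  where
  eq : ∀ i j → (i ℤ.+ j) ℤ.- i ≡ j ℤ.- + 0
  eq = solve-∀

ℓ¹≡0⇒≡ : ∀ {n} (x y : Point n) → ℓ¹ x y ≡ 0 → x ≡ y
ℓ¹≡0⇒≡ []      []      _  = refl
ℓ¹≡0⇒≡ (i ∷ x) (j ∷ y) eq = cong₂ _∷_
  (ℤ.i-j≡0⇒i≡j i j (ℤ.∣i∣≡0⇒i≡0 (ℕ.m+n≡0⇒m≡0 _ eq)))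
  (ℓ¹≡0⇒≡ x y (ℕ.m+n≡0⇒n≡0 ∣ i ℤ.- j ∣ eq))

-- Unit balls of the lattice graph through the ℓ¹ distance.

Ball₁⇒ℓ¹≤1 : ∀ {n} {u v : Point n} → u ∈ Ball (L n) 1 v → ℓ¹ u v ≤ 1
Ball₁⇒ℓ¹≤1 {u = u} (0 , ([] , _)     , _) = subst (_≤ 1) (sym (ℓ¹-refl u)) z≤n
Ball₁⇒ℓ¹≤1         (1 , (e ∷ [] , _) , _) = ℕ.≤-reflexive e
Ball₁⇒ℓ¹≤1         (suc (suc _) , _  , s≤s ())

ℓ¹≤1⇒Ball₁ : ∀ {n} {u v : Point n} → ℓ¹ u v ≤ 1 → u ∈ Ball (L n) 1 v
ℓ¹≤1⇒Ball₁ {u = u} {v} d≤1 with ℕ.n≤1⇒n≡0∨n≡1 d≤1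
... | inj₁ d≡0 with refl ← ℓ¹≡0⇒≡ u v d≡0 = 0 , ([] , λ _ → z≤n) , z≤n
... | inj₂ d≡1 = 1 , (d≡1 ∷ [] , minimal) , s≤s z≤n
  where
  minimal : ∀ {k} → Walk Adjacent u v k → 1 ≤ k
  minimal []      = contradiction (trans (sym d≡1) (ℓ¹-refl u)) λ ()
  minimal (_ ∷ _) = s≤s z≤n

-- An explicit list, so that the finite checks can be settled by evaluation.
ball₁ : ∀ n → List (Point n)
ball₁ n = filter (λ x → ℓ¹ x 𝟎 ℕ.≤? 1) (Q n 1)

∈-ball₁ : ∀ {n} {x : Point n} → ℓ¹ x 𝟎 ≤ 1 → x List.∈ ball₁ n
∈-ball₁ {x = x} d≤1 =
  ∈-filter⁺ (λ x → ℓ¹ x 𝟎 ℕ.≤? 1) (Equivalence.from ∈-Q (coordinates x d≤1)) d≤1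
  where
  coordinates : ∀ {n m} (x : Point n) → ℓ¹ x 𝟎 ≤ m → VecAll.All (λ i → ∣ i ∣ ≤ m) x
  coordinates []      _   = VecAll.[]
  coordinates (i ∷ x) d≤m =
    subst (_≤ _) (cong ∣_∣ (ℤ.+-identityʳ i)) (ℕ.m+n≤o⇒m≤o _ d≤m) VecAll.∷
    coordinates x (ℕ.m+n≤o⇒n≤o ∣ i ℤ.- + 0 ∣ d≤m)

-- Residues modulo 18

-- Divisibility of a difference, rather than equality of remainders, makes periodicity an instance
-- of closure of multiples under addition.
InS : Pred ℤ _
InS k = Any (λ s → + 18 ∣ k ℤ.- + s) (0 List.∷ 1 List.∷ 3 List.∷ 9 List.∷ List.[])

InS? : Decidable InS
InS? k = any? (λ s → + 18 ∣? k ℤ.- + s) _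

InS-periodic : ∀ k q → InS k → InS (k ℤ.+ q ℤ.* + 18)
InS-periodic k q = ListAny.map λ {s} d →
  subst (+ 18 ∣_) (eq k q (+ s)) (∣m∣n⇒∣m+n d (divides q refl))
  where
  eq : ∀ k q s → (k ℤ.- s) ℤ.+ q ℤ.* + 18 ≡ (k ℤ.+ q ℤ.* + 18) ℤ.- s
  eq = solve-∀

-- The shift `j` is quantified inside, so one `r` describes membership at all the points around a
-- given one. Adding `q` or `- q` periods gives the two inclusions.
residue : ∀ k → ∃[ r ] r List.∈ upTo 18 ×
          (λ j → InS (+ r ℤ.+ j)) ≐ (λ j → InS (k ℤ.+ j))
residue k = r , ∈-upTo⁺ (n%ℕd<d k 18) ,
  (λ {j} → subst InS (up j) ∘ InS-periodic (+ r ℤ.+ j) q) ,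
  (λ {j} → subst InS (down j) ∘ InS-periodic (k ℤ.+ j) (ℤ.- q))
  where
  r = k %ℕ 18
  q = k /ℕ 18
  up′ : ∀ r q j → (r ℤ.+ j) ℤ.+ q ℤ.* + 18 ≡ (r ℤ.+ q ℤ.* + 18) ℤ.+ j
  up′ = solve-∀
  down′ : ∀ r q j → ((r ℤ.+ q ℤ.* + 18) ℤ.+ j) ℤ.+ (ℤ.- q) ℤ.* + 18 ≡ r ℤ.+ j
  down′ = solve-∀
  up : ∀ j → (+ r ℤ.+ j) ℤ.+ q ℤ.* + 18 ≡ k ℤ.+ j
  up j = trans (up′ (+ r) q j) (cong (ℤ._+ j) (sym (a≡a%ℕn+[a/ℕn]*n k 18)))
  down : ∀ j → (k ℤ.+ j) ℤ.+ (ℤ.- q) ℤ.* + 18 ≡ + r ℤ.+ j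
  down j = trans (cong (λ k → (k ℤ.+ j) ℤ.+ (ℤ.- q) ℤ.* + 18) (a≡a%ℕn+[a/ℕn]*n k 18))
                 (down′ (+ r) q j)

-- The code

φ : Point 4 → ℤ
φ (a ∷ b ∷ c ∷ d ∷ []) = + 3 ℤ.* a ℤ.+ + 4 ℤ.* b ℤ.+ + 8 ℤ.* c ℤ.+ d

φ-⊕ : ∀ x y → φ (x ⊕ y) ≡ φ x ℤ.+ φ y
φ-⊕ (a ∷ b ∷ c ∷ d ∷ []) (a′ ∷ b′ ∷ c′ ∷ d′ ∷ []) = eq a b c d a′ b′ c′ d′
  where
  eq : ∀ a b c d a′ b′ c′ d′ →
       + 3 ℤ.* (a ℤ.+ a′) ℤ.+ + 4 ℤ.* (b ℤ.+ b′) ℤ.+ + 8 ℤ.* (c ℤ.+ c′) ℤ.+ (d ℤ.+ d′) ≡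
       (+ 3 ℤ.* a ℤ.+ + 4 ℤ.* b ℤ.+ + 8 ℤ.* c ℤ.+ d) ℤ.+
       (+ 3 ℤ.* a′ ℤ.+ + 4 ℤ.* b′ ℤ.+ + 8 ℤ.* c′ ℤ.+ d′)
  eq = solve-∀

code : Code (L 4)
code = record
  { members  = InS ∘ φ
  ; member?  = InS? ∘ φ
  ; nonempty = 𝟎 , from-yes (InS? (φ 𝟎))
  }

-- Carries a codeword found by a check at the residue `r` over to its translate by `c`; additivity
-- of `φ` makes this possible.
translate-InS : ∀ {r} c x → (λ j → InS (+ r ℤ.+ j)) ≐ (λ j → InS (φ c ℤ.+ j)) →
                InS (+ r ℤ.+ φ x) → InS (φ (c ⊕ x))
translate-InS c x r≐ = subst InS (sym (φ-⊕ c x)) ∘ proj₁ r≐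

-- Finite checks over the residues.

Covered : Pred ℕ _
Covered r = Any (λ x → InS (+ r ℤ.+ φ x) × ℓ¹ x 𝟎 ≤ 1) (ball₁ 4)

covered? : Decidable Covered
covered? r = any? (λ x → InS? (+ r ℤ.+ φ x) ×-dec ℓ¹ x 𝟎 ℕ.≤? 1) (ball₁ 4)

-- The origin stands for a point `c` common to two unit balls, with `φ c` congruent to `r`; `x` and
-- `y` are the centres relative to `c`. The candidates for `z` form the unit ball around `x`.
Separated : ℕ → Rel (Point 4) _
Separated r x y =
  Any (λ z → InS (+ r ℤ.+ φ z) × ℓ¹ z x ≤ 1 × ¬ ℓ¹ z y ≤ 1) (map (x ⊕_) (ball₁ 4))

separated? : ∀ r x y → Dec (Separated r x y)
separated? r x y = any?
  (λ z → InS? (+ r ℤ.+ φ z) ×-dec ℓ¹ z x ℕ.≤? 1 ×-dec ¬? (ℓ¹ z y ℕ.≤? 1))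
  (map (x ⊕_) (ball₁ 4))

residues-covered : ListAll.All Covered (upTo 18)
residues-covered = from-yes (ListAll.all? covered? (upTo 18))

-- Two different sets may differ by an element of either one, hence both orders of `x` and `y`.
residues-separated :
  ListAll.All (λ r → ListAll.All (λ x → ListAll.All (λ y →
    x ≡ y ⊎ Separated r x y ⊎ Separated r y x) (ball₁ 4)) (ball₁ 4)) (upTo 18)
residues-separated = from-yes (
  ListAll.all? (λ r → ListAll.all? (λ x → ListAll.all? (λ y →
    ≡-dec ℤ._≟_ x y ⊎-dec separated? r x y ⊎-dec separated? r y x)
    (ball₁ 4)) (ball₁ 4)) (upTo 18))

residues-window :
  ListAll.All (λ r → length (filter (λ k → InS? (+ r ℤ.+ + k)) (upTo 18)) ≡ 4) (upTo 18)
residues-window = from-yes (ListAll.all?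
  (λ r → length (filter (λ k → InS? (+ r ℤ.+ + k)) (upTo 18)) ℕ.≟ 4) (upTo 18))

-- Covering and separation.

covering : ∀ v → Satisfiable (Ball (L 4) 1 v ∩ Code.members code)
covering v =
  let r , r∈ , r≐       = residue (φ v)
      -- `satisfied` forgets that `x` comes from `ball₁ 4`; the norm bound survives as part of
      -- `Covered`.
      x , x∈S , ∥x∥≤1 = satisfied (ListAll.lookup residues-covered r∈)
  in  v ⊕ x
    , ℓ¹≤1⇒Ball₁ (subst (_≤ 1) (sym (ℓ¹-⊕ v x)) ∥x∥≤1)
    , translate-InS v x r≐ x∈S

-- Translation by `c` preserves distances and, at the residue `r`, membership. The witness `z` of
-- the check thus becomes a codeword `c ⊕ z` near `u` and far from `v`.
Separated⇒⊈ : ∀ {r} c {u v} → (λ j → InS (+ r ℤ.+ j)) ≐ (λ j → InS (φ c ℤ.+ j)) →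
              Separated r (u ⊖ c) (v ⊖ c) →
              ¬ (Ball (L 4) 1 u ∩ Code.members code ⊆ Ball (L 4) 1 v ∩ Code.members code)
Separated⇒⊈ c {u} {v} r≐ sep I⊆ =
  let z , z∈S , near , far = satisfied sep
      c⊕z∈Bu = ℓ¹≤1⇒Ball₁ {u = c ⊕ z} {u} (subst (_≤ 1) (sym (relative u z)) near)
      c⊕z∈Bv = proj₁ (I⊆ {c ⊕ z} (c⊕z∈Bu , translate-InS c z r≐ z∈S))
  in  far (subst (_≤ 1) (relative v z) (Ball₁⇒ℓ¹≤1 {u = c ⊕ z} {v} c⊕z∈Bv))
  where
  relative : ∀ w z → ℓ¹ (c ⊕ z) w ≡ ℓ¹ z (w ⊖ c)
  relative w z = trans (cong (ℓ¹ (c ⊕ z)) (sym (⊕-⊖ c w))) (ℓ¹-translate c z (w ⊖ c))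

separated : ∀ {r} {x y : Point 4} → r List.∈ upTo 18 → ℓ¹ x 𝟎 ≤ 1 → ℓ¹ y 𝟎 ≤ 1 →
            x ≡ y ⊎ Separated r x y ⊎ Separated r y x
separated {r} {x} {y} r∈ ∥x∥≤1 ∥y∥≤1 =
  ListAll.lookup {xs = ball₁ 4} (ListAll.lookup {xs = ball₁ 4}
    (ListAll.lookup {xs = upTo 18} residues-separated r∈)
    (∈-ball₁ {4} ∥x∥≤1)) (∈-ball₁ {4} ∥y∥≤1)

separating : ∀ {u v} → u ≢ v →
             ¬ (Ball (L 4) 1 u ∩ Code.members code ≐ Ball (L 4) 1 v ∩ Code.members code)
separating {u} {v} u≢v (I⊆ , I⊇) =
  -- A codeword near `u` is also near `v` by the assumed inclusion, so both centres relative to `c`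
  -- fall within the range of the finite check.
  let c , c∈Bu , c∈C = covering u
      r , r∈ , r≐    = residue (φ c)
      c∈Bv            = proj₁ (I⊆ {c} (c∈Bu , c∈C))
  in  cases c r≐ (separated {r} {u ⊖ c} {v ⊖ c} r∈ (∥⊖∥≤1 c c∈Bu) (∥⊖∥≤1 c c∈Bv))
  where
  ∥⊖∥≤1 : ∀ c {w} → c ∈ Ball (L 4) 1 w → ℓ¹ (w ⊖ c) 𝟎 ≤ 1
  ∥⊖∥≤1 c {w} c∈B =
    subst (_≤ 1) (trans (ℓ¹-sym c w) (sym (ℓ¹-⊖ w c))) (Ball₁⇒ℓ¹≤1 {u = c} {w} c∈B)
  cases : ∀ {r} c → (λ j → InS (+ r ℤ.+ j)) ≐ (λ j → InS (φ c ℤ.+ j)) →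
          ¬ (u ⊖ c ≡ v ⊖ c ⊎ Separated r (u ⊖ c) (v ⊖ c) ⊎ Separated r (v ⊖ c) (u ⊖ c))
  cases c r≐ (inj₁ eq)         = u≢v (trans (sym (⊕-⊖ c u)) (trans (cong (c ⊕_) eq) (⊕-⊖ c v)))
  cases c r≐ (inj₂ (inj₁ sep)) = Separated⇒⊈ c {u} {v} r≐ sep I⊆
  cases c r≐ (inj₂ (inj₂ sep)) = Separated⇒⊈ c {v} {u} r≐ sep I⊇

identifying : IsIdentifying (L 4) 1 code
identifying = record { covering = covering ; separating = separating }

-- Density

length-cartesianProductWith : ∀ {A B C : Set} (f : A → B → C) xs ys →
  length (cartesianProductWith f xs ys) ≡ length xs ℕ.* length ys
length-cartesianProductWith f List.[]       ys = refl
length-cartesianProductWith f (x List.∷ xs) ys = trans (length-++ (map (f x) ys))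
  (cong₂ ℕ._+_ (length-map (f x) ys) (length-cartesianProductWith f xs ys))

length-interval : ∀ m → length (interval m) ≡ suc (m ℕ.+ m)
length-interval m = trans (length-map _ (upTo (suc (m ℕ.+ m)))) (length-upTo (suc (m ℕ.+ m)))

length-Q : ∀ n m → length (Q n m) ≡ length (interval m) ℕ.^ n
length-Q zero    m = refl
length-Q (suc n) m = trans (length-cartesianProductWith _∷_ (interval m) (Q n m))
  (cong (length (interval m) ℕ.*_) (length-Q n m))

length-filter-map : ∀ {A B : Set} {P : Pred B 0ℓ} (P? : Decidable P) (f : A → B) xs →
  length (filter P? (map f xs)) ≡ length (filter (P? ∘ f) xs)
length-filter-map P? f List.[] = refl
length-filter-map P? f (x List.∷ xs) with P? (f x)
... | yes _ = cong suc (length-filter-map P? f xs)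
... | no  _ = length-filter-map P? f xs

-- Bounds of the shape `a * count ≤ b` express a density as an inequality in ℕ and add up over the
-- slices.
length-filter-slices : ∀ {A B C : Set} {P : Pred C 0ℓ} (P? : Decidable P)
  (f : A → B → C) a b xs ys →
  (∀ x → a ℕ.* length (filter (P? ∘ f x) ys) ≤ b) →
  a ℕ.* length (filter P? (cartesianProductWith f xs ys)) ≤ length xs ℕ.* b
length-filter-slices P? f a b List.[]       ys bound = ℕ.≤-reflexive (ℕ.*-zeroʳ a)
length-filter-slices P? f a b (x List.∷ xs) ys bound = begin
  a ℕ.* length (filter P? (map (f x) ys List.++ rest))
    ≡⟨ cong (λ zs → a ℕ.* length zs) (filter-++ P? (map (f x) ys) rest) ⟩
  a ℕ.* length (filter P? (map (f x) ys) List.++ filter P? rest)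
    ≡⟨ cong (a ℕ.*_) (length-++ (filter P? (map (f x) ys))) ⟩
  a ℕ.* (length (filter P? (map (f x) ys)) ℕ.+ length (filter P? rest))
    ≡⟨ ℕ.*-distribˡ-+ a (length (filter P? (map (f x) ys))) _ ⟩
  a ℕ.* length (filter P? (map (f x) ys)) ℕ.+ a ℕ.* length (filter P? rest)
    ≡⟨ cong (λ k → a ℕ.* k ℕ.+ a ℕ.* length (filter P? rest))
            (length-filter-map P? (f x) ys) ⟩
  a ℕ.* length (filter (P? ∘ f x) ys) ℕ.+ a ℕ.* length (filter P? rest)
    ≤⟨ ℕ.+-mono-≤ (bound x) (length-filter-slices P? f a b xs ys bound) ⟩
  b ℕ.+ length xs ℕ.* b ∎
  where
  open ℕ.≤-Reasoning
  rest = cartesianProductWith f xs ys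

-- Peeling off the first coordinates one by one leaves lines in the last direction, the one in which
-- `φ` has coefficient 1.
length-filter-lines : ∀ {n} {P : Pred (Point (suc n)) 0ℓ} (P? : Decidable P) a b m →
  (∀ z → a ℕ.* length (filter (λ i → P? (z ∷ʳ i)) (interval m)) ≤ b) →
  a ℕ.* length (filter P? (Q (suc n) m)) ≤ length (interval m) ℕ.^ n ℕ.* b
length-filter-lines {zero} P? a b m bound = begin
  a ℕ.* length (filter P? (cartesianProductWith _∷_ (interval m) (List.[ [] ])))
    ≡⟨ cong (λ xs → a ℕ.* length (filter P? xs)) (singletons (interval m)) ⟩
  a ℕ.* length (filter P? (map (_∷ []) (interval m)))
    ≡⟨ cong (a ℕ.*_) (length-filter-map P? (_∷ []) (interval m)) ⟩
  a ℕ.* length (filter (λ i → P? (i ∷ [])) (interval m))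
    ≤⟨ bound [] ⟩
  b
    ≡⟨ ℕ.+-identityʳ b ⟨
  1 ℕ.* b ∎
  where
  open ℕ.≤-Reasoning
  singletons : ∀ is → cartesianProductWith {C = Point 1} _∷_ is (List.[ [] ]) ≡ map (_∷ []) is
  singletons List.[]       = refl
  singletons (i List.∷ is) = cong ((i ∷ []) List.∷_) (singletons is)
length-filter-lines {suc n} P? a b m bound = begin
  a ℕ.* length (filter P? (Q (suc (suc n)) m))
    ≤⟨ length-filter-slices P? _∷_ a _ (interval m) (Q (suc n) m)
         (λ i → length-filter-lines (λ x → P? (i ∷ x)) a b m (λ z → bound (i ∷ z))) ⟩
  l ℕ.* (l ℕ.^ n ℕ.* b)
    ≡⟨ ℕ.*-assoc l (l ℕ.^ n) b ⟨
  l ℕ.^ suc n ℕ.* b ∎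
  where
  open ℕ.≤-Reasoning
  l = length (interval m)

-- Rotating to the residue of `c` reduces this to the finite check. Consecutive integers are given
-- by a function `g` because `applyUpTo g (18 + l)` then unfolds to a window followed by the same
-- kind of list for `g ∘ (18 +_)`.
window : ∀ g c → (∀ k → g k ≡ c ℤ.+ + k) →
         length (filter InS? (applyUpTo g 18)) ≡ 4
window g c g≗ = begin
  length (filter InS? (applyUpTo g 18))
    ≡⟨ cong (length ∘ filter InS?) (map-upTo g 18) ⟨
  length (filter InS? (map g (upTo 18)))
    ≡⟨ length-filter-map InS? g (upTo 18) ⟩
  length (filter (InS? ∘ g) (upTo 18))
    ≡⟨ cong length (filter-≐ (InS? ∘ g) (λ k → InS? (+ r ℤ.+ + k))
         ( (λ {k} → proj₂ r≐ ∘ subst InS (g≗ k))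
         , (λ {k} → subst InS (sym (g≗ k)) ∘ proj₁ r≐)) (upTo 18)) ⟩
  length (filter (λ k → InS? (+ r ℤ.+ + k)) (upTo 18))
    ≡⟨ ListAll.lookup residues-window (proj₁ (proj₂ (residue c))) ⟩
  4 ∎
  where
  open ≡-Reasoning
  r = proj₁ (residue c)
  r≐ = proj₂ (proj₂ (residue c))

-- The constant 126 = 7 · 18 pays for the s ≤ 18 points outside the q windows, at
-- most all of which are codewords: 9 s ≤ 2 s + 126.
windows : ∀ q s g c → s ≤ 18 → (∀ k → g k ≡ c ℤ.+ + k) →
  let l = q ℕ.* 18 ℕ.+ s in
  9 ℕ.* length (filter InS? (applyUpTo g l)) ≤ 2 ℕ.* l ℕ.+ 126
windows zero    s g c s≤18 g≗ = begin
  9 ℕ.* length (filter InS? (applyUpTo g s))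
    ≤⟨ ℕ.*-monoʳ-≤ 9 (length-filter InS? (applyUpTo g s)) ⟩
  9 ℕ.* length (applyUpTo g s)
    ≡⟨ cong (9 ℕ.*_) (length-applyUpTo g s) ⟩
  9 ℕ.* s
    ≡⟨ ℕ.*-distribʳ-+ s 2 7 ⟩
  2 ℕ.* s ℕ.+ 7 ℕ.* s
    ≤⟨ ℕ.+-monoʳ-≤ (2 ℕ.* s) (ℕ.*-monoʳ-≤ 7 s≤18) ⟩
  2 ℕ.* s ℕ.+ 126 ∎
  where open ℕ.≤-Reasoning
windows (suc q) s g c s≤18 g≗ = begin
  9 ℕ.* length (filter InS? (applyUpTo g 18 List.++ rest))
    ≡⟨ cong (λ xs → 9 ℕ.* length xs) (filter-++ InS? (applyUpTo g 18) rest) ⟩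
  9 ℕ.* length (filter InS? (applyUpTo g 18) List.++ filter InS? rest)
    ≡⟨ cong (9 ℕ.*_) (length-++ (filter InS? (applyUpTo g 18))) ⟩
  9 ℕ.* (length (filter InS? (applyUpTo g 18)) ℕ.+ length (filter InS? rest))
    ≡⟨ cong (λ k → 9 ℕ.* (k ℕ.+ length (filter InS? rest))) (window g c g≗) ⟩
  9 ℕ.* (4 ℕ.+ length (filter InS? rest))
    ≡⟨ ℕ.*-distribˡ-+ 9 4 _ ⟩
  36 ℕ.+ 9 ℕ.* length (filter InS? rest)
    ≤⟨ ℕ.+-monoʳ-≤ 36 (windows q s (g ∘ (18 ℕ.+_)) (c ℤ.+ + 18) s≤18 g′≗) ⟩
  36 ℕ.+ (2 ℕ.* l ℕ.+ 126)
    ≡⟨ eq l ⟩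
  2 ℕ.* (18 ℕ.+ l) ℕ.+ 126 ∎
  where
  open ℕ.≤-Reasoning
  l = q ℕ.* 18 ℕ.+ s
  rest = applyUpTo (g ∘ (18 ℕ.+_)) l
  g′≗ : ∀ k → g (18 ℕ.+ k) ≡ c ℤ.+ + 18 ℤ.+ + k
  g′≗ k = trans (g≗ (18 ℕ.+ k)) (sym (ℤ.+-assoc c (+ 18) (+ k)))
  eq : ∀ l → 36 ℕ.+ (2 ℕ.* l ℕ.+ 126) ≡ 2 ℕ.* (18 ℕ.+ l) ℕ.+ 126
  eq = ℕ-Solver.solve-∀

-- Along the line `φ` grows by 1 at each step, so its values are consecutive integers from `e - m`
-- on. They are cut into `l / 18` full windows and a remainder.
line : ∀ m z → 9 ℕ.* length (filter (λ i → InS? (φ (z ∷ʳ i))) (interval m)) ≤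
       2 ℕ.* length (interval m) ℕ.+ 126
line m z@(a ∷ b ∷ c ∷ []) = begin
  9 ℕ.* length (filter (λ i → InS? (φ (z ∷ʳ i))) (interval m))
    ≡⟨ cong (9 ℕ.*_) (length-filter-map InS? (λ i → φ (z ∷ʳ i)) (interval m)) ⟨
  9 ℕ.* length (filter InS? (map (λ i → φ (z ∷ʳ i)) (interval m)))
    ≡⟨ cong (λ xs → 9 ℕ.* length (filter InS? xs)) points ⟩
  9 ℕ.* length (filter InS? (applyUpTo g l))
    ≡⟨ cong (λ l → 9 ℕ.* length (filter InS? (applyUpTo g l))) l≡ ⟩
  9 ℕ.* length (filter InS? (applyUpTo g (l ℕ./ 18 ℕ.* 18 ℕ.+ l ℕ.% 18)))
    ≤⟨ windows (l ℕ./ 18) (l ℕ.% 18) g (e ℤ.- + m) (ℕ.<⇒≤ (m%n<n l 18)) (λ k → eq e (+ k) (+ m)) ⟩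
  2 ℕ.* (l ℕ./ 18 ℕ.* 18 ℕ.+ l ℕ.% 18) ℕ.+ 126
    ≡⟨ cong (λ l → 2 ℕ.* l ℕ.+ 126) (sym (trans (length-interval m) l≡)) ⟩
  2 ℕ.* length (interval m) ℕ.+ 126 ∎
  where
  open ℕ.≤-Reasoning
  l = suc (m ℕ.+ m)
  e = + 3 ℤ.* a ℤ.+ + 4 ℤ.* b ℤ.+ + 8 ℤ.* c
  g = λ k → φ (z ∷ʳ (+ k ℤ.- + m))
  points : map (λ i → φ (z ∷ʳ i)) (interval m) ≡ applyUpTo g l
  points = trans (sym (map-∘ {g = λ i → φ (z ∷ʳ i)} {f = λ k → + k ℤ.- + m} (upTo l)))
                 (map-upTo g l)
  l≡ : l ≡ l ℕ./ 18 ℕ.* 18 ℕ.+ l ℕ.% 18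
  l≡ = trans (m≡m%n+[m/n]*n l 18) (ℕ.+-comm (l ℕ.% 18) _)
  eq : ∀ e k m → e ℤ.+ (k ℤ.- m) ≡ e ℤ.- m ℤ.+ k
  eq = solve-∀

-- Rational estimates and the limit superior.

/-≤ : ∀ n d .{{_ : NonZero d}} p → + n ℤ.* ℚ.↧ p ℤ.≤ ℚ.↥ p ℤ.* + d → + n / d ℚ.≤ p
/-≤ n d@(suc _) p@record{} n/d≤p = ℚ.toℚᵘ-cancel-≤
  -- `_/_` reduces its fraction; in the unnormalised rationals `n` and `d` are still visible and
  -- cross multiplication applies.
  (ℚᵘ.≤-respˡ-≃ (ℚᵘ.≃-sym (ℚ.toℚᵘ-fromℚᵘ (+ n ℚᵘ./ d))) (ℚᵘ.*≤* n/d≤p))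

-- The count on lines gives a proportion of at most 2/9 + 14/l, where l = 2m + 1. For p = a/b above
-- 2/9 integrality yields 2b + 1 ≤ 9a, and the extra 1, multiplied by l, absorbs the error 126b as
-- soon as 126b ≤ l.
proportion-bound : ∀ {p} → + 2 / 9 ℚ.< p → ∀ m → 126 ℕ.* ℚ.↧ₙ p ≤ m → proportion code m ℚ.≤ p
proportion-bound {mkℚ -[1+ _ ] _ _} (ℚ.*<* ())
proportion-bound {p@(mkℚ (+ a) d-1 _)} (ℚ.*<* 2/9<a/b) m 126b≤m =
  /-≤ n (length (Q 4 m)) {{Q-nonZero 4 m}} p (subst₂ ℤ._≤_ (ℤ.pos-* n b) (ℤ.pos-* a _)
    (ℤ.+≤+ (ℕ.*-cancelˡ-≤ 9 scaled)))
  where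
  b = suc d-1
  n = length (filter (Code.member? code) (Q 4 m))
  l = length (interval m)
  open ℕ.≤-Reasoning
  2b<9a : 2 ℕ.* b ℕ.< a ℕ.* 9
  2b<9a = ℤ.drop‿+<+ (subst₂ ℤ._<_ (sym (ℤ.pos-* 2 b)) (sym (ℤ.pos-* a 9)) 2/9<a/b)
  e₁ : ∀ c l b → c ℕ.* (2 ℕ.* l ℕ.+ 126) ℕ.* b ≡ c ℕ.* (2 ℕ.* b ℕ.* l ℕ.+ 126 ℕ.* b)
  e₁ = ℕ-Solver.solve-∀
  e₂ : ∀ c l b → c ℕ.* (2 ℕ.* b ℕ.* l ℕ.+ l) ≡ c ℕ.* (suc (2 ℕ.* b) ℕ.* l)
  e₂ = ℕ-Solver.solve-∀
  e₃ : ∀ c l a → c ℕ.* (a ℕ.* 9 ℕ.* l) ≡ 9 ℕ.* (a ℕ.* (l ℕ.* c))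
  e₃ = ℕ-Solver.solve-∀
  126b≤l : 126 ℕ.* b ≤ l
  126b≤l = ℕ.≤-trans 126b≤m (subst (m ≤_) (sym (length-interval m))
    (ℕ.m≤n⇒m≤1+n (ℕ.m≤m+n m m)))
  scaled : 9 ℕ.* (n ℕ.* b) ≤ 9 ℕ.* (a ℕ.* length (Q 4 m))
  scaled = begin
    9 ℕ.* (n ℕ.* b)
      ≡⟨ ℕ.*-assoc 9 n b ⟨
    9 ℕ.* n ℕ.* b
      ≤⟨ ℕ.*-monoˡ-≤ b (length-filter-lines (Code.member? code) 9 _ m (line m)) ⟩
    l ℕ.^ 3 ℕ.* (2 ℕ.* l ℕ.+ 126) ℕ.* b
      ≡⟨ e₁ (l ℕ.^ 3) l b ⟩
    l ℕ.^ 3 ℕ.* (2 ℕ.* b ℕ.* l ℕ.+ 126 ℕ.* b)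
      ≤⟨ ℕ.*-monoʳ-≤ (l ℕ.^ 3) (ℕ.+-monoʳ-≤ (2 ℕ.* b ℕ.* l) 126b≤l) ⟩
    l ℕ.^ 3 ℕ.* (2 ℕ.* b ℕ.* l ℕ.+ l)
      ≡⟨ e₂ (l ℕ.^ 3) l b ⟩
    l ℕ.^ 3 ℕ.* (suc (2 ℕ.* b) ℕ.* l)
      ≤⟨ ℕ.*-monoʳ-≤ (l ℕ.^ 3) (ℕ.*-monoˡ-≤ l 2b<9a) ⟩
    l ℕ.^ 3 ℕ.* (a ℕ.* 9 ℕ.* l)
      ≡⟨ e₃ (l ℕ.^ 3) l a ⟩
    9 ℕ.* (a ℕ.* l ℕ.^ 4)
      ≡⟨ cong (λ k → 9 ℕ.* (a ℕ.* k)) (length-Q 4 m) ⟨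
    9 ℕ.* (a ℕ.* length (Q 4 m)) ∎

theorem4 : 𝒟 4 1 ≤ᵘ fromℚ (+ 2 / 9)
theorem4 2/9<q =
  -- The cut of `sup` asks for a bound strictly below `q`; an intermediate `p` also keeps the slack
  -- above 2/9 that absorbs the incomplete windows.
  let p , 2/9<p , p<q = ℚ.<-dense 2/9<q
      N               = 126 ℕ.* ℚ.↧ₙ p
  in  (code , identifying) , N , p , p<q ,
      λ k → proportion-bound 2/9<p (N ℕ.+ k) (ℕ.m≤m+n N k)
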